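{- Let $k,t$ be integers with $k\geq 7$ and $k\geq t+1$, and let $H$ be a non-empty graph of order $t$. Then $$\operatorname{gr}_k(P_5:H)=\left\lceil\frac{1+\sqrt{1+8k}}{2}\right\rceil .$$
   Context: All graphs are finite, simple and undirected; a graph is non-empty if it has at least one edge; the order of a graph is its number of vertices. $K_n$ is the complete graph on $n$ vertices and $P_5$ is the path with $5$ vertices and $4$ edges. A $k$-edge-coloring assigns to each edge one of $k$ colors; all $k$-edge-colorings are assumed exact, i.e. each of the $k$ colors is used at least once. An edge-colored graph is rainbow if all its edges have different colors and monochromatic if all its edges have a single color. A copy of a graph means a (not necessarily induced) subgraph isomorphic to it. For non-empty graphs $G,H$ and a positive integer $k$, the Gallai-Ramsey number $\operatorname{gr}_k(G:H)$ is the minimum integer $N$ with $\binom{N}{2}\geq k$ (so that $K_N$ admits a $k$-edge-coloring) such that for all $n\geq N$, every $k$-edge-coloring of $K_n$ contains either a rainbow copy of $G$ or a monochromatic copy of $H$. -}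

module Defs where

open import Data.Fin.Base using (Fin; toℕ)
import Data.Fin.Properties as Fin
open import Data.Integer.Base as ℤ using (ℤ; +_)
open import Data.Nat.Base as ℕ using (ℕ; suc)
import Data.Nat.Properties as ℕ
open import Data.Nat.Combinatorics using (_C_)
open import Data.Product.Base using (∃; ∃₂; ∃-syntax; _×_; _,_)
open import Data.Rational.Base as ℚ
  using (ℚ; 0ℚ; 1ℚ; ½; _+_; _*_; _-_; -_; _<_; _≤_; 1/_; _/_)
import Data.Rational.Properties as ℚ
open import Data.Rational.Solver using (module +-*-Solver)
open import Data.Sum.Base using (_⊎_; inj₁; inj₂; swap)
open import Function.Base using (_∘_)
open import Function.Definitions using (Injective)
open import Level using (0ℓ)
open import Relation.Binary.Core using (Rel)
open import Relation.Binary.Definitions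
  using (Decidable; Irreflexive; Symmetric)
open import Relation.Binary.PropositionalEquality
open import Relation.Nullary using (¬_; yes; no; contradiction)
open import Relation.Nullary.Decidable using (¬?; _⊎-dec_)

------------------------------------------------------------------------
-- Graphs

record Graph (n : ℕ) : Set₁ where
  field
    Adj    : Rel (Fin n) 0ℓ
    adj?   : Decidable Adj
    symm   : Symmetric Adj
    irrefl : Irreflexive _≡_ Adj

open Graph public using (Adj)

NonEmpty : ∀ {n} → Graph n → Set
NonEmpty G = ∃₂ λ u v → Adj G u v

complete : ∀ n → Graph n
complete n = record
  { Adj    = _≢_
  ; adj?   = λ u v → ¬? (u Fin.≟ v)
  ; symm   = ≢-sym
  ; irrefl = λ u≡v u≢v → u≢v u≡v
  }

path : ∀ n → Graph n
path n = record
  { Adj    = λ u v → toℕ v ≡ suc (toℕ u) ⊎ toℕ u ≡ suc (toℕ v)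
  ; adj?   = λ u v → (toℕ v ℕ.≟ suc (toℕ u)) ⊎-dec (toℕ u ℕ.≟ suc (toℕ v))
  ; symm   = swap
  ; irrefl = λ { refl (inj₁ eq) → ℕ.1+n≢n (sym eq)
               ; refl (inj₂ eq) → ℕ.1+n≢n (sym eq) }
  }

-- A copy of G in F is the image of an injective homomorphism; it need not
-- be induced.

record Copy {m n} (G : Graph m) (F : Graph n) : Set where
  field
    to        : Fin m → Fin n
    injective : Injective _≡_ _≡_ to
    edge      : ∀ {u v} → Adj G u v → Adj F (to u) (to v)

------------------------------------------------------------------------
-- Edge colourings

-- `undirected` quantifies over all pairs of adjacency proofs, so (by `symm`)
-- the colour also does not depend on the proof that u and v are adjacent.

record Colouring (k : ℕ) {n} (F : Graph n) : Set where
  field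
    colour     : ∀ {u v} → Adj F u v → Fin k
    undirected : ∀ {u v} (e : Adj F u v) (e′ : Adj F v u) →
                 colour e ≡ colour e′

open Colouring public using (colour)

Exact : ∀ {k n} {F : Graph n} → Colouring k F → Set
Exact {k} {n} {F} c =
  ∀ (i : Fin k) → ∃₂ λ u v → ∃ λ (e : Adj F u v) → colour c e ≡ i

module _ {k m n} {G : Graph m} {F : Graph n} (c : Colouring k F) where

  Rainbow : Copy G F → Set
  Rainbow γ = ∀ {u v x y} (e : Adj G u v) (e′ : Adj G x y) →
    colour c (edge e) ≡ colour c (edge e′) →
    (u ≡ x × v ≡ y) ⊎ (u ≡ y × v ≡ x)
    where open Copy γ

  Monochromatic : Copy G F → Set
  Monochromatic γ = ∃ λ (i : Fin k) →
    ∀ {u v} (e : Adj G u v) → colour c (edge e) ≡ i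
    where open Copy γ

------------------------------------------------------------------------
-- Gallai–Ramsey numbers

module _ (k : ℕ) {s t} (G : Graph s) (H : Graph t) where

  Unavoidable : ℕ → Set
  Unavoidable n = (c : Colouring k (complete n)) → Exact c →
    ∃ (Rainbow {G = G} c) ⊎ ∃ (Monochromatic {G = H} c)

  Admissible : ℕ → Set
  Admissible N = N C 2 ℕ.≥ k × (∀ n → n ℕ.≥ N → Unavoidable n)

  -- gr_k(G : H) = N
  IsGallaiRamsey : ℕ → Set
  IsGallaiRamsey N = Admissible N × (∀ M → Admissible M → N ℕ.≤ M)

------------------------------------------------------------------------
-- Real numbers, as two-sided Dedekind cuts:
-- L q means q < x, and U q means x < q.

record ℝ : Set₁ where
  field
    L U         : ℚ → Set
    L-inhabited : ∃ L
    U-inhabited : ∃ U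
    L-closed    : ∀ {q r} → q < r → L r → L q
    U-closed    : ∀ {q r} → q < r → U q → U r
    L-open      : ∀ {q} → L q → ∃[ r ] q < r × L r
    U-open      : ∀ {q} → U q → ∃[ r ] r < q × U r
    disjoint    : ∀ {q} → L q → ¬ U q
    located     : ∀ {q r} → q < r → L q ⊎ U r

_≤ᶻ_ : ℝ → ℤ → Set
x ≤ᶻ m = ¬ ℝ.L x (m / 1)

-- ⌈ x ⌉ = m
IsCeiling : ℝ → ℤ → Set
IsCeiling x m = x ≤ᶻ m × (∀ m′ → x ≤ᶻ m′ → m ℤ.≤ m′)

private
  open +-*-Solver

  p-q+q≡p : ∀ p q → p - q + q ≡ p
  p-q+q≡p = solve 2 (λ p q → p :- q :+ q := p) refl

  p+q-q≡p : ∀ p q → p + q - q ≡ p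
  p+q-q≡p = solve 2 (λ p q → p :+ q :- q := p) refl

  p-q<r⇒p<r+q : ∀ {p q r} → p - q < r → p < r + q
  p-q<r⇒p<r+q {p} {q} lt =
    subst (_< _) (p-q+q≡p p q) (ℚ.+-monoˡ-< q lt)

  r<p-q⇒r+q<p : ∀ {p q r} → r < p - q → r + q < p
  r<p-q⇒r+q<p {p} {q} lt =
    subst (_ <_) (p-q+q≡p p q) (ℚ.+-monoˡ-< q lt)

  half+half : ∀ p → ½ * p + ½ * p ≡ p
  half+half p = trans (sym (ℚ.*-distribʳ-+ p ½ ½)) (ℚ.*-identityˡ p)

  half-double : ∀ p → ½ * (p + p) ≡ p
  half-double p = trans (ℚ.*-distribˡ-+ ½ p p) (half+half p)

infixr 6 _+ʳ_
infixr 7 ½*_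
infix  8 √_

_+ʳ_ : ℚ → ℝ → ℝ
p +ʳ x = record
  { L           = λ q → L (q - p)
  ; U           = λ q → U (q - p)
  ; L-inhabited = let q , l = L-inhabited in
                  q + p , subst L (sym (p+q-q≡p q p)) l
  ; U-inhabited = let q , u = U-inhabited in
                  q + p , subst U (sym (p+q-q≡p q p)) u
  ; L-closed    = L-closed ∘ ℚ.+-monoˡ-< (- p)
  ; U-closed    = U-closed ∘ ℚ.+-monoˡ-< (- p)
  ; L-open      = λ l → let r , lt , l′ = L-open l in
                  r + p , p-q<r⇒p<r+q lt , subst L (sym (p+q-q≡p r p)) l′
  ; U-open      = λ u → let r , lt , u′ = U-open u in
                  r + p , r<p-q⇒r+q<p lt , subst U (sym (p+q-q≡p r p)) u′
  ; disjoint    = disjoint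
  ; located     = located ∘ ℚ.+-monoˡ-< (- p)
  }
  where open ℝ x

½*_ : ℝ → ℝ
½* x = record
  { L           = λ q → L (q + q)
  ; U           = λ q → U (q + q)
  ; L-inhabited = let q , l = L-inhabited in
                  ½ * q , subst L (sym (half+half q)) l
  ; U-inhabited = let q , u = U-inhabited in
                  ½ * q , subst U (sym (half+half q)) u
  ; L-closed    = λ lt → L-closed (ℚ.+-mono-< lt lt)
  ; U-closed    = λ lt → U-closed (ℚ.+-mono-< lt lt)
  ; L-open      = λ {q} l → let r , lt , l′ = L-open l in
                  ½ * r
                  , subst (_< ½ * r) (half-double q) (ℚ.*-monoʳ-<-pos ½ lt)
                  , subst L (sym (half+half r)) l′
  ; U-open      = λ {q} u → let r , lt , u′ = U-open u in
                  ½ * r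
                  , subst (½ * r <_) (half-double q) (ℚ.*-monoʳ-<-pos ½ lt)
                  , subst U (sym (half+half r)) u′
  ; disjoint    = disjoint
  ; located     = λ lt → located (ℚ.+-mono-< lt lt)
  }
  where open ℝ x

private
  *-pos : ∀ {p q} → 0ℚ < p → 0ℚ < q → 0ℚ < p * q
  *-pos {p} {q} 0<p 0<q = subst (_< p * q) (ℚ.*-zeroˡ q)
    (ℚ.*-monoˡ-<-pos q ⦃ ℚ.positive 0<q ⦄ 0<p)

  p<q⇒0<q-p : ∀ {p q} → p < q → 0ℚ < q - p
  p<q⇒0<q-p {p} {q} lt =
    subst (_< q - p) (ℚ.+-inverseʳ p) (ℚ.+-monoˡ-< (- p) lt)

  0<q-p⇒p<q : ∀ {p q} → 0ℚ < q - p → p < q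
  0<q-p⇒p<q {p} {q} lt = subst₂ _<_ (ℚ.+-identityˡ p) (p-q+q≡p q p)
    (ℚ.+-monoˡ-< p lt)

  square-mono-< : ∀ {p q} → 0ℚ ≤ p → p < q → p * p < q * q
  square-mono-< {p} {q} 0≤p p<q = ℚ.≤-<-trans
    (ℚ.*-monoˡ-≤-nonNeg p ⦃ ℚ.nonNegative 0≤p ⦄ (ℚ.<⇒≤ p<q))
    (ℚ.*-monoˡ-<-pos q ⦃ ℚ.positive (ℚ.≤-<-trans 0≤p p<q) ⦄ p<q)

  -- One step towards √ a from q, staying on the same side:
  -- r = (b q + a) / (q + b), where b = a + 1, so that b² > a.
  module Step (a q : ℚ) (0≤a : 0ℚ ≤ a) (0≤q : 0ℚ ≤ q) where
    b d : ℚ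
    b = a + 1ℚ
    d = q + b

    0<b : 0ℚ < b
    0<b = ℚ.+-mono-≤-< 0≤a (ℚ.positive⁻¹ 1ℚ)

    0<d : 0ℚ < d
    0<d = ℚ.+-mono-≤-< 0≤q 0<b

    instance
      d-pos : ℚ.Positive d
      d-pos = ℚ.positive 0<d
      d-nonZero : ℚ.NonZero d
      d-nonZero = ℚ.pos⇒nonZero d

    i r e : ℚ
    i = 1/ d
    r = q + (a - q * q) * i
    e = i * i * (b * b - a)

    0<i : 0ℚ < i
    0<i = ℚ.positive⁻¹ i ⦃ ℚ.1/pos⇒pos d ⦄

    0<e : 0ℚ < e
    0<e = *-pos (*-pos 0<i 0<i) (subst (0ℚ <_) (eq a)
      (ℚ.+-mono-≤-< (ℚ.≤-trans (ℚ.≤-reflexive (sym (ℚ.*-zeroʳ a)))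
        (ℚ.*-monoˡ-≤-nonNeg a ⦃ ℚ.nonNegative 0≤a ⦄ 0≤a)) 0<b))
      where
      eq : ∀ a → a * a + (a + 1ℚ) ≡ (a + 1ℚ) * (a + 1ℚ) - a
      eq = solve 1 (λ a → a :* a :+ (a :+ con 1ℚ)
             := (a :+ con 1ℚ) :* (a :+ con 1ℚ) :- a) refl

    r-q : r - q ≡ (a - q * q) * i
    r-q = solve 2 (λ q x → q :+ x :- q := x) refl q ((a - q * q) * i)

    q-r : q - r ≡ (q * q - a) * i
    q-r = solve 3 (λ q a i → q :- (q :+ (a :- q :* q) :* i)
                     := (q :* q :- a) :* i) refl q a i

    -- a − r², after multiplying by powers of s = 1 to make it homogeneous
    F : ℚ → ℚ
    F s = (a - q * q) * s * s - (q + q) * (a - q * q) * i * s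
          - (a - q * q) * (a - q * q) * i * i

    a-r² : a - r * r ≡ (a - q * q) * e
    a-r² = trans
      (solve 3 (λ q a i →
         a :- (q :+ (a :- q :* q) :* i) :* (q :+ (a :- q :* q) :* i)
         := (a :- q :* q) :* con 1ℚ :* con 1ℚ
            :- (q :+ q) :* (a :- q :* q) :* i :* con 1ℚ
            :- (a :- q :* q) :* (a :- q :* q) :* i :* i) refl q a i)
      (trans (cong F (sym (ℚ.*-inverseʳ d)))
      (solve 4 (λ q a i b →
         (a :- q :* q) :* ((q :+ b) :* i) :* ((q :+ b) :* i)
            :- (q :+ q) :* (a :- q :* q) :* i :* ((q :+ b) :* i)
            :- (a :- q :* q) :* (a :- q :* q) :* i :* i
         := (a :- q :* q) :* (i :* i :* (b :* b :- a))) refl q a i b))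

    r²-a : r * r - a ≡ (q * q - a) * e
    r²-a = trans (sym (neg (r * r) a)) (trans (cong -_ a-r²)
      (solve 3 (λ a x e → :- ((a :- x) :* e) := (x :- a) :* e) refl a (q * q) e))
      where
      neg : ∀ x y → - (y - x) ≡ x - y
      neg = solve 2 (λ x y → :- (y :- x) := x :- y) refl

    up : q * q < a → q < r × r * r < a
    up lt = 0<q-p⇒p<q (subst (0ℚ <_) (sym r-q) (*-pos (p<q⇒0<q-p lt) 0<i))
          , 0<q-p⇒p<q (subst (0ℚ <_) (sym a-r²) (*-pos (p<q⇒0<q-p lt) 0<e))

    down : a < q * q → r < q × a < r * r
    down lt = 0<q-p⇒p<q (subst (0ℚ <_) (sym q-r) (*-pos (p<q⇒0<q-p lt) 0<i))
            , 0<q-p⇒p<q (subst (0ℚ <_) (sym r²-a) (*-pos (p<q⇒0<q-p lt) 0<e))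

    r*d : r * d ≡ b * q + a
    r*d = trans
      (solve 4 (λ q a i b → (q :+ (a :- q :* q) :* i) :* (q :+ b)
         := q :* (q :+ b) :+ (a :- q :* q) :* ((q :+ b) :* i)) refl q a i b)
      (trans (cong (λ s → q * d + (a - q * q) * s) (ℚ.*-inverseʳ d))
      (solve 3 (λ q a b → q :* (q :+ b) :+ (a :- q :* q) :* con 1ℚ
         := b :* q :+ a) refl q a b))

    0<r : 0ℚ < q → 0ℚ < r
    0<r 0<q = ℚ.*-cancelʳ-<-nonNeg d ⦃ ℚ.pos⇒nonNeg d ⦄
      (subst₂ _<_ (sym (ℚ.*-zeroˡ d)) (sym r*d)
        (ℚ.+-mono-<-≤ (*-pos 0<b 0<q) 0≤a))

√_ : ℕ → ℝ
√ n = record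
  { L           = L′
  ; U           = U′
  ; L-inhabited = - 1ℚ , inj₁ (ℚ.negative⁻¹ (- 1ℚ))
  ; U-inhabited = a + 1ℚ , 0<a+1 , a<[a+1]²
  ; L-closed    = closed
  ; U-closed    = λ { q<r (0<q , lt) → ℚ.<-trans 0<q q<r
                    , ℚ.<-trans lt (square-mono-< (ℚ.<⇒≤ 0<q) q<r) }
  ; L-open      = open′
  ; U-open      = λ { {q} (0<q , lt) →
                    let open Step a q 0≤a (ℚ.<⇒≤ 0<q)
                        r<q , lt′ = down lt
                    in r , r<q , 0<r 0<q , lt′ }
  ; disjoint    = λ { (inj₁ q<0) (0<q , _) → ℚ.<-asym q<0 0<q
                    ; (inj₂ lt) (_ , gt) → ℚ.<-asym lt gt }
  ; located     = located′
  }
  where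
  a : ℚ
  a = + n / 1

  L′ U′ : ℚ → Set
  L′ q = q < 0ℚ ⊎ q * q < a
  U′ q = 0ℚ < q × a < q * q

  0≤a : 0ℚ ≤ a
  0≤a = ℚ.nonNegative⁻¹ a ⦃ ℚ.normalize-nonNeg n 1 ⦄

  0<a+1 : 0ℚ < a + 1ℚ
  0<a+1 = ℚ.+-mono-≤-< 0≤a (ℚ.positive⁻¹ 1ℚ)

  a<[a+1]² : a < (a + 1ℚ) * (a + 1ℚ)
  a<[a+1]² = ℚ.<-≤-trans a<a+1 (subst (_≤ (a + 1ℚ) * (a + 1ℚ))
    (ℚ.*-identityʳ (a + 1ℚ))
    (ℚ.*-monoˡ-≤-nonNeg (a + 1ℚ) ⦃ ℚ.nonNegative (ℚ.<⇒≤ 0<a+1) ⦄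
      (ℚ.+-monoˡ-≤ 1ℚ 0≤a)))
    where
    a<a+1 : a < a + 1ℚ
    a<a+1 = subst (_< a + 1ℚ) (ℚ.+-identityʳ a)
      (ℚ.+-monoʳ-< a (ℚ.positive⁻¹ 1ℚ))

  closed : ∀ {q r} → q < r → L′ r → L′ q
  closed {q} q<r l with q ℚ.<? 0ℚ | l
  ... | yes q<0 | _        = inj₁ q<0
  ... | no  q≮0 | inj₁ r<0 = contradiction (ℚ.<-trans q<r r<0) q≮0
  ... | no  q≮0 | inj₂ lt  =
    inj₂ (ℚ.<-trans (square-mono-< (ℚ.≮⇒≥ q≮0) q<r) lt)

  open′ : ∀ {q} → L′ q → ∃[ r ] q < r × L′ r
  open′ {q} l with q ℚ.<? 0ℚ | l
  ... | yes q<0 | _        = let r , q<r , r<0 = ℚ.<-dense q<0 in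
                             r , q<r , inj₁ r<0
  ... | no  q≮0 | inj₁ q<0 = contradiction q<0 q≮0
  ... | no  q≮0 | inj₂ lt  =
    let open Step a q 0≤a (ℚ.≮⇒≥ q≮0)
        q<r , lt′ = up lt
    in r , q<r , inj₂ lt′

  located′ : ∀ {q r} → q < r → L′ q ⊎ U′ r
  located′ {q} q<r with q ℚ.<? 0ℚ | q * q ℚ.<? a
  ... | yes q<0 | _      = inj₁ (inj₁ q<0)
  ... | no  _   | yes lt = inj₁ (inj₂ lt)
  ... | no  q≮0 | no ≮a  = inj₂
    ( ℚ.≤-<-trans (ℚ.≮⇒≥ q≮0) q<r
    , ℚ.≤-<-trans (ℚ.≮⇒≥ ≮a) (square-mono-< (ℚ.≮⇒≥ q≮0) q<r) )

{-# OPTIONS --safe #-}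
module Submission where

open import Defs
open import Data.Empty using (⊥; ⊥-elim)
open import Data.Fin.Base using (Fin; zero; suc; toℕ; inject₁; inject≤; punchIn)
import Data.Fin.Properties as Fin
open import Data.Integer.Base as ℤ using (ℤ; +_; -[1+_]; +<+; -<+)
import Data.Integer.Properties as ℤ
open import Data.List.Base using (List; []; _∷_; length; lookup)
open import Data.List.Relation.Unary.All as All using (All; []; _∷_)
open import Data.List.Relation.Unary.All.Properties using (¬Any⇒All¬)
import Data.List.Relation.Unary.Any as Any
open import Data.List.Relation.Unary.Any.Properties using (lookup-index)
open import Data.Nat.Base as ℕ using (ℕ; zero; suc; _+_; _*_; _≥_; s≤s; z≤n)
open import Data.Nat.Combinatorics using (_C_; nC1≡n; nCk+nC[k+1]≡[n+1]C[k+1])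
open import Data.Nat.Coprimality using (1-coprimeTo) renaming (sym to coprime-sym)
import Data.Nat.Properties as ℕ
open import Data.Nat.Solver using (module +-*-Solver)
open import Data.Product.Base using (∃; ∃₂; ∃-syntax; _×_; _,_; proj₁; proj₂)
open import Data.Rational.Base as ℚ using (ℚ; mkℚ; 1ℚ)
import Data.Rational.Properties as ℚ
open import Data.Sum.Base as Sum using (_⊎_; inj₁; inj₂; [_,_]′)
open import Data.Vec.Base as Vec using (Vec; []; _∷_)
open import Data.Vec.Relation.Unary.All using ([]; _∷_)
open import Data.Vec.Relation.Unary.AllPairs using (allPairs?; []; _∷_)
open import Data.Vec.Relation.Unary.Unique.Propositional using (Unique)
open import Data.Vec.Relation.Unary.Unique.Propositional.Properties
  using (lookup-injective)
open import Function.Base using (_∘_)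
open import Relation.Binary.PropositionalEquality
open import Relation.Nullary using (¬_; Dec; yes; no; contradiction)
open import Relation.Nullary.Decidable using (decidable-stable; _×-dec_; ¬?)
open import Relation.Unary using (Decidable)

-- The condition N C 2 ≥ k is part of the definition of gr, and its least
-- solution N is the ceiling, because (2N − 1)² = 1 + 8 (N C 2).  It remains to
-- find a monochromatic H in every exact k-colouring of K_n without a rainbow
-- P₅; such a K_n has n ≥ 5.
--
-- A vertex a that sees three colours misses at most one of the k ≥ 7 colours,
-- hence sees at least six, and this forces K_n − a to be monochromatic.  If no
-- vertex sees three colours, then the colour pairs of any two vertices meet,
-- and for a suitable colour α every other colour is seen by a vertex that also
-- sees α.  Either way there is an α such that one vertex can be chosen for
-- every other colour with all the chosen vertices joined in α: a monochromatic
-- K_{k−1}, which contains H as k − 1 ≥ t.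

-- Distinctness, and elements outside a short list

unique? : ∀ {m n} (xs : Vec (Fin n) m) → Dec (Unique xs)
unique? = allPairs? (λ x y → ¬? (x Fin.≟ y))

-- If every element occurred in `xs`, two of them would share a position by the pigeonhole
-- principle, and looking that position up would identify them.
fresh : ∀ {n} (xs : List (Fin n)) → length xs ℕ.< n → ∃ λ x → All (x ≢_) xs
fresh {n} xs len<n with Fin.any? (λ x → All.all? (λ y → ¬? (x Fin.≟ y)) xs)
... | yes found = found
... | no  none  =
  let i , j , i<j , eq = Fin.pigeonhole len<n (Any.index ∘ covered)
  in contradiction
       (trans (lookup-index (covered i))
         (trans (cong (lookup xs) eq) (sym (lookup-index (covered j)))))
       (Fin.<⇒≢ i<j)
  where
  covered : ∀ x → Any.Any (x ≡_) xs
  covered x = decidable-stable (Any.any? (x Fin.≟_) xs)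
    (λ x∉xs → none (x , ¬Any⇒All¬ xs x∉xs))

-- Total symmetric colour functions without a rainbow P₅; diagonal values carry no meaning

module NoRainbowPath {n k} (c : Fin n → Fin n → Fin k)
  (c-sym : ∀ u v → c u v ≡ c v u)
  (no-rainbow : ∀ {v₁ v₂ v₃ v₄ v₅} →
    Unique (v₁ ∷ v₂ ∷ v₃ ∷ v₄ ∷ v₅ ∷ []) →
    ¬ Unique (c v₁ v₂ ∷ c v₂ v₃ ∷ c v₃ v₄ ∷ c v₄ v₅ ∷ []))
  (onto : ∀ i → ∃₂ λ u v → u ≢ v × c u v ≡ i)
  (n≥5 : n ≥ 5) (k≥7 : k ≥ 7)
  where

  V C : Set
  V = Fin n
  C = Fin k

  by-sym : ∀ {u v p} → c u v ≢ p → c v u ≢ p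
  by-sym {u} {v} ne eq = ne (trans (c-sym u v) eq)

  -- Paths through a fixed vertex `a`

  module At (a : V) where

    f : V → C
    f = c a

    apart : ∀ {u v} → f u ≢ f v → u ≢ v
    apart ne eq = ne (cong f eq)

    -- the path x a y z w
    no-spoke : ∀ {x y z w} → a ≢ x → a ≢ y → a ≢ z → a ≢ w →
      x ≢ z → x ≢ w → y ≢ z → y ≢ w → z ≢ w →
      ¬ Unique (f x ∷ f y ∷ c y z ∷ c z w ∷ [])
    no-spoke {x} {y} {z} {w} a≢x a≢y a≢z a≢w x≢z x≢w y≢z y≢w z≢w
      us@((x≢y ∷ _) ∷ _) = no-rainbow
        ( (≢-sym a≢x ∷ apart x≢y ∷ x≢z ∷ x≢w ∷ [])
        ∷ (a≢y ∷ a≢z ∷ a≢w ∷ [])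
        ∷ (y≢z ∷ y≢w ∷ [])
        ∷ (z≢w ∷ [])
        ∷ [] ∷ [])
        (subst (λ p → Unique (p ∷ f y ∷ c y z ∷ c z w ∷ [])) (c-sym a x) us)

    -- the path s z a x x′
    no-broom : ∀ {s z x x′} → a ≢ s → a ≢ z → a ≢ x → a ≢ x′ →
      s ≢ z → s ≢ x → s ≢ x′ → z ≢ x′ → x ≢ x′ →
      ¬ Unique (c s z ∷ f z ∷ f x ∷ c x x′ ∷ [])
    no-broom {s} {z} {x} {x′} a≢s a≢z a≢x a≢x′ s≢z s≢x s≢x′ z≢x′ x≢x′
      us@(_ ∷ (z≢x ∷ _) ∷ _) = no-rainbow
        ( (s≢z ∷ ≢-sym a≢s ∷ s≢x ∷ s≢x′ ∷ [])
        ∷ (≢-sym a≢z ∷ apart z≢x ∷ z≢x′ ∷ [])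
        ∷ (a≢x ∷ a≢x′ ∷ [])
        ∷ (x≢x′ ∷ [])
        ∷ [] ∷ [])
        (subst (λ p → Unique (c s z ∷ p ∷ f x ∷ c x x′ ∷ [])) (c-sym a z) us)

    -- Otherwise the path `s z a x x′` is rainbow, unless `c x x′` equals `f x`; then it differs
    -- from `f x′`, and the path `s z a x′ x` is rainbow.
    broom-closes : ∀ {s z x x′} → a ≢ s → a ≢ z → a ≢ x → a ≢ x′ →
      s ≢ z → s ≢ x → s ≢ x′ → c s z ≢ f z →
      c s z ≢ f x → c s z ≢ f x′ → f z ≢ f x → f z ≢ f x′ → f x ≢ f x′ →
      c x x′ ≡ c s z ⊎ c x x′ ≡ f z
    broom-closes {s} {z} {x} {x′} a≢s a≢z a≢x a≢x′ s≢z s≢x s≢x′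
      sz≢z sz≢x sz≢x′ z≢x z≢x′ x≢x′
      with c x x′ Fin.≟ c s z | c x x′ Fin.≟ f z | c x x′ Fin.≟ f x
    ... | yes eq | _ | _ = inj₁ eq
    ... | no _ | yes eq | _ = inj₂ eq
    ... | no ≢sz | no ≢z | no ≢x = ⊥-elim
      (no-broom a≢s a≢z a≢x a≢x′ s≢z s≢x s≢x′ (apart z≢x′) (apart x≢x′)
        ((sz≢z ∷ sz≢x ∷ ≢-sym ≢sz ∷ [])
        ∷ (z≢x ∷ ≢-sym ≢z ∷ []) ∷ (≢-sym ≢x ∷ []) ∷ [] ∷ []))
    ... | no ≢sz | no ≢z | yes eq = ⊥-elim
      (no-broom a≢s a≢z a≢x′ a≢x s≢z s≢x′ s≢x (apart z≢x) (≢-sym (apart x≢x′))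
        ((sz≢z ∷ sz≢x′ ∷ ≢-sym (by-sym ≢sz) ∷ [])
        ∷ (z≢x′ ∷ ≢-sym (by-sym ≢z) ∷ [])
        ∷ ((λ eq′ → x≢x′ (trans (sym eq) (trans (c-sym x x′) (sym eq′)))) ∷ [])
        ∷ [] ∷ []))

    -- A trichromatic vertex misses at most one colour

    Missing : C → Set
    Missing i = ∀ v → a ≢ v → f v ≢ i

    Three : V → V → V → Set
    Three x y z = All (a ≢_) (x ∷ y ∷ z ∷ []) × Unique (f x ∷ f y ∷ f z ∷ [])

    Trichromatic : Set
    Trichromatic = ∃ λ x → ∃ λ y → ∃ λ z → Three x y z

    two-others : Trichromatic → ∀ p →
      ∃₂ λ x x′ → a ≢ x × a ≢ x′ × f x ≢ p × f x′ ≢ p × f x ≢ f x′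
    two-others (x , y , z , a≢x ∷ a≢y ∷ a≢z ∷ []
               , (x≢y ∷ x≢z ∷ []) ∷ (y≢z ∷ []) ∷ _) p
      with f x Fin.≟ p | f y Fin.≟ p
    ... | yes refl | _ = y , z , a≢y , a≢z , ≢-sym x≢y , ≢-sym x≢z , y≢z
    ... | no x≢p | yes refl = x , z , a≢x , a≢z , x≢p , ≢-sym y≢z , x≢z
    ... | no x≢p | no y≢p = x , y , a≢x , a≢y , x≢p , y≢p , x≢y

    flip : ∀ {u v} → Missing (c u v) → Missing (c v u)
    flip {u} {v} = subst Missing (c-sym u v)

    offˡ : ∀ {u v} → u ≢ v → Missing (c u v) → a ≢ u
    offˡ u≢v m refl = m _ u≢v refl

    offʳ : ∀ {u v} → u ≢ v → Missing (c u v) → a ≢ v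
    offʳ u≢v m = offˡ (≢-sym u≢v) (flip m)

    -- On the path `x a y z w` the last two colours differ and are missing at `a`, so only a
    -- coincidence of `f x` and `f y` keeps it from being rainbow.
    missing-spoke : ∀ {x y z w} → a ≢ x → a ≢ y → a ≢ z → a ≢ w →
      x ≢ z → x ≢ w → y ≢ z → y ≢ w → z ≢ w →
      Missing (c y z) → Missing (c z w) → c y z ≢ c z w → f x ≡ f y
    missing-spoke {x} {y} a≢x a≢y a≢z a≢w x≢z x≢w y≢z y≢w z≢w m m′ ne =
      decidable-stable (f x Fin.≟ f y) λ x≢y →
        no-spoke a≢x a≢y a≢z a≢w x≢z x≢w y≢z y≢w z≢w
          ((x≢y ∷ m x a≢x ∷ m′ x a≢x ∷ []) ∷ (m y a≢y ∷ m′ y a≢y ∷ [])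
          ∷ (ne ∷ []) ∷ [] ∷ [])

    -- By `missing-spoke`, away from `a` and `z`, `f` agrees with `f y` except perhaps at `w`, and
    -- with `f w` except perhaps at `y`. A fifth vertex `v` links the two values, so `f` is constant
    -- there; but `a` sees two different colours besides `f z`.
    no-adjacent-missing : Trichromatic → ∀ {y z w} →
      a ≢ y → a ≢ z → a ≢ w → y ≢ z → w ≢ z →
      Missing (c y z) → Missing (c w z) → c y z ≢ c w z → ⊥
    no-adjacent-missing tri {y} {z} {w} a≢y a≢z a≢w y≢z w≢z m m′ ne
      with fresh (a ∷ y ∷ z ∷ w ∷ []) n≥5 | two-others tri (f z)
    ... | v , v≢a ∷ v≢y ∷ v≢z ∷ v≢w ∷ []
        | x , x′ , a≢x , a≢x′ , x≢z , x′≢z , x≢x′ =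
      x≢x′ (trans (const x a≢x (apart x≢z)) (sym (const x′ a≢x′ (apart x′≢z))))
      where
      y≢w : y ≢ w
      y≢w refl = ne refl

      near-y : ∀ x → a ≢ x → x ≢ z → x ≢ w → f x ≡ f y
      near-y x a≢x x≢z x≢w =
        missing-spoke a≢x a≢y a≢z a≢w x≢z x≢w y≢z y≢w (≢-sym w≢z)
          m (flip m′) (λ eq → ne (trans eq (c-sym z w)))

      near-w : ∀ x → a ≢ x → x ≢ z → x ≢ y → f x ≡ f w
      near-w x a≢x x≢z x≢y =
        missing-spoke a≢x a≢w a≢z a≢y x≢z x≢y w≢z (≢-sym y≢w) (≢-sym y≢z)
          m′ (flip m) (λ eq → ne (trans (c-sym y z) (sym eq)))

      const : ∀ x → a ≢ x → x ≢ z → f x ≡ f v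
      const x a≢x x≢z with x Fin.≟ w
      ... | yes refl = sym (near-w v (≢-sym v≢a) v≢z v≢y)
      ... | no x≢w = trans (near-y x a≢x x≢z x≢w)
                       (sym (near-y v (≢-sym v≢a) v≢z v≢w))

    -- By `ends`, `f` takes a single value on `y`, `z`, `u`, `v`. Two further colours at `a` give
    -- `x` and `x′`. Brooms through both edges force `c x x′ ≡ f u`, then `c x u ≡ f x` follows, and
    -- one last path is rainbow.
    no-disjoint-missing : Trichromatic → ∀ {y z u v} →
      a ≢ y → a ≢ z → a ≢ u → a ≢ v → y ≢ z → u ≢ v →
      u ≢ y → u ≢ z → v ≢ y → v ≢ z →
      Missing (c y z) → Missing (c u v) → c y z ≢ c u v → ⊥
    no-disjoint-missing tri {y} {z} {u} {v}
      a≢y a≢z a≢u a≢v y≢z u≢v u≢y u≢z v≢y v≢z m m′ ne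
      with two-others tri (f u)
    ... | x , x′ , a≢x , a≢x′ , x≢u , x′≢u , x≢x′ = final
      where
      -- the path s t a s′ t′
      ends : ∀ {s t s′ t′} → a ≢ s → a ≢ t → a ≢ s′ → a ≢ t′ → s ≢ t → s′ ≢ t′ →
        s ≢ s′ → s ≢ t′ → t ≢ t′ →
        Missing (c s t) → Missing (c s′ t′) → c s t ≢ c s′ t′ → f t ≡ f s′
      ends {s} {t} {s′} a≢s a≢t a≢s′ a≢t′ s≢t s′≢t′ s≢s′ s≢t′ t≢t′ m m′ ne =
        decidable-stable (f t Fin.≟ f s′) λ t≢s′ →
          no-broom a≢s a≢t a≢s′ a≢t′ s≢t s≢s′ s≢t′ t≢t′ s′≢t′
            ((≢-sym (m t a≢t) ∷ ≢-sym (m s′ a≢s′) ∷ ne ∷ [])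
            ∷ (t≢s′ ∷ m′ t a≢t ∷ []) ∷ (m′ s′ a≢s′ ∷ []) ∷ [] ∷ [])

      u≡y : f u ≡ f y
      u≡y = ends a≢v a≢u a≢y a≢z (≢-sym u≢v) y≢z v≢y v≢z u≢z (flip m′) m
              (≢-sym λ eq → ne (trans eq (c-sym v u)))
      u≡z : f u ≡ f z
      u≡z = ends a≢v a≢u a≢z a≢y (≢-sym u≢v) (≢-sym y≢z) v≢z v≢y u≢y (flip m′) (flip m)
              (≢-sym λ eq → ne (trans (c-sym y z) (trans eq (c-sym v u))))
      y≡v : f y ≡ f v
      y≡v = ends a≢z a≢y a≢v a≢u (≢-sym y≢z) (≢-sym u≢v)
              (≢-sym v≢z) (≢-sym u≢z) (≢-sym u≢y) (flip m) (flip m′)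
              λ eq → ne (trans (c-sym y z) (trans eq (c-sym v u)))

      off : ∀ {s t} → f u ≡ f s → f t ≢ f u → s ≢ t
      off u≡s t≢u s≡t = t≢u (sym (trans u≡s (cong f s≡t)))

      closes : ∀ {s t} → a ≢ s → a ≢ t → s ≢ t → f u ≡ f s → f u ≡ f t →
        Missing (c s t) → c x x′ ≡ c s t ⊎ c x x′ ≡ f u
      closes {s} {t} a≢s a≢t s≢t u≡s u≡t m = Sum.map₂ (λ eq → trans eq (sym u≡t))
        (broom-closes a≢s a≢t a≢x a≢x′ s≢t (off u≡s x≢u) (off u≡s x′≢u)
          (≢-sym (m t a≢t)) (≢-sym (m x a≢x)) (≢-sym (m x′ a≢x′))
          (λ t≡x → x≢u (sym (trans u≡t t≡x))) (λ t≡x → x′≢u (sym (trans u≡t t≡x)))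
          x≢x′)

      u≡v : f u ≡ f v
      u≡v = trans u≡y y≡v

      xx′ : c x x′ ≡ f u
      xx′ with closes a≢y a≢z y≢z u≡y u≡z m | closes a≢u a≢v u≢v refl u≡v m′
      ... | inj₂ eq | _ = eq
      ... | inj₁ _ | inj₂ eq = eq
      ... | inj₁ eq | inj₁ eq′ = ⊥-elim (ne (trans (sym eq) eq′))

      -- Otherwise the path `y z a x u` is rainbow, unless `c x u` is `c y z` or `f u`; in both of
      -- these cases `x′ a x u v` is rainbow.
      xu : c x u ≡ f x
      xu = decidable-stable (c x u Fin.≟ f x) contra
        where
        spoke : c x u ≢ f x → c x u ≢ f x′ → c x u ≢ c u v → ⊥
        spoke ≢x ≢x′ ≢uv = no-spoke a≢x′ a≢x a≢u a≢v
          (apart x′≢u) (≢-sym (off u≡v x′≢u)) (apart x≢u) (≢-sym (off u≡v x≢u)) u≢v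
          ((≢-sym x≢x′ ∷ ≢-sym ≢x′ ∷ m′ x′ a≢x′ ∷ []) ∷ (≢-sym ≢x ∷ m′ x a≢x ∷ [])
          ∷ (≢uv ∷ []) ∷ [] ∷ [])

        contra : c x u ≢ f x → ⊥
        contra ≢x with c x u Fin.≟ c y z | c x u Fin.≟ f u
        ... | no ≢yz | no ≢u = no-broom a≢y a≢z a≢x a≢u y≢z
          (off u≡y x≢u) (≢-sym u≢y) (≢-sym u≢z) (apart x≢u)
          ((≢-sym (m z a≢z) ∷ ≢-sym (m x a≢x) ∷ ≢-sym ≢yz ∷ [])
          ∷ ((λ z≡x → x≢u (sym (trans u≡z z≡x)))
            ∷ (λ z≡ → ≢u (sym (trans u≡z z≡))) ∷ [])
          ∷ (≢-sym ≢x ∷ []) ∷ [] ∷ [])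
        ... | yes eq | _ = spoke ≢x
          (λ eq′ → m x′ a≢x′ (trans (sym eq′) eq)) (λ eq′ → ne (trans (sym eq) eq′))
        ... | no _ | yes eq = spoke ≢x
          (λ eq′ → x′≢u (trans (sym eq′) eq)) (λ eq′ → m′ u a≢u (trans (sym eq) eq′))

      -- the path a x′ x u v
      final : ⊥
      final = no-rainbow
        ( (a≢x′ ∷ a≢x ∷ a≢u ∷ a≢v ∷ [])
        ∷ (≢-sym (apart x≢x′) ∷ apart x′≢u ∷ ≢-sym (off u≡v x′≢u) ∷ [])
        ∷ (apart x≢u ∷ ≢-sym (off u≡v x≢u) ∷ [])
        ∷ (u≢v ∷ [])
        ∷ [] ∷ [])
        (subst₂ (λ p q → Unique (f x′ ∷ p ∷ q ∷ c u v ∷ []))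
          (trans (sym xx′) (c-sym x x′)) (sym xu)
          ((x′≢u ∷ ≢-sym x≢x′ ∷ m′ x′ a≢x′ ∷ [])
          ∷ (≢-sym x≢u ∷ m′ u a≢u ∷ [])
          ∷ (m′ x a≢x ∷ []) ∷ [] ∷ []))

    no-two-missing : Trichromatic → ∀ {y z u v} → y ≢ z → u ≢ v →
      Missing (c y z) → Missing (c u v) → c y z ≢ c u v → ⊥
    no-two-missing tri {y} {z} {u} {v} y≢z u≢v m m′ ne
      with u Fin.≟ y | u Fin.≟ z | v Fin.≟ y | v Fin.≟ z
    ... | no u≢y | no u≢z | no v≢y | no v≢z =
      no-disjoint-missing tri (offˡ y≢z m) (offʳ y≢z m) (offˡ u≢v m′) (offʳ u≢v m′)
        y≢z u≢v u≢y u≢z v≢y v≢z m m′ ne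
    ... | yes refl | _ | _ | _ =
      no-adjacent-missing tri (offʳ y≢z m) (offˡ y≢z m) (offʳ u≢v m′)
        (≢-sym y≢z) (≢-sym u≢v) (flip m) (flip m′)
        (λ eq → ne (trans (c-sym y z) (trans eq (c-sym v u))))
    ... | no _ | yes refl | _ | _ =
      no-adjacent-missing tri (offˡ y≢z m) (offʳ y≢z m) (offʳ u≢v m′)
        y≢z (≢-sym u≢v) m (flip m′) (λ eq → ne (trans eq (c-sym v u)))
    ... | no _ | no _ | yes refl | _ =
      no-adjacent-missing tri (offʳ y≢z m) (offˡ y≢z m) (offˡ u≢v m′)
        (≢-sym y≢z) u≢v (flip m) m′ (λ eq → ne (trans (c-sym y z) eq))
    ... | no _ | no _ | no _ | yes refl =
      no-adjacent-missing tri (offˡ y≢z m) (offʳ y≢z m) (offˡ u≢v m′)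
        y≢z u≢v m m′ ne

    -- This is where k ≥ 7 enters: at least two colours lie outside a list of five, and if `a` saw
    -- neither, their edges would contradict `no-two-missing`.
    sees-beyond : Trichromatic → ∀ (is : List C) → length is ℕ.≤ 5 →
      ∃ λ x → a ≢ x × All (f x ≢_) is
    sees-beyond tri is len≤5
      with Fin.any? (λ x → ¬? (a Fin.≟ x) ×-dec All.all? (λ i → ¬? (f x Fin.≟ i)) is)
    ... | yes found = found
    ... | no none with fresh is (ℕ.≤-trans (s≤s len≤5) (ℕ.<⇒≤ k≥7))
    ... | i , i∉is with fresh (i ∷ is) (ℕ.≤-trans (s≤s (s≤s len≤5)) k≥7)
    ... | j , j≢i ∷ j∉is with onto i | onto j
    ... | y , z , y≢z , refl | u , v , u≢v , refl =
      ⊥-elim (no-two-missing tri y≢z u≢v (unseen i∉is) (unseen j∉is) (≢-sym j≢i))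
      where
      unseen : ∀ {i} → All (i ≢_) is → Missing i
      unseen i∉is v a≢v refl = none (v , a≢v , i∉is)

    -- Excluding adjacent edges of different colours `β` and `γ` away from `a`

    record Ray (β γ : C) (x : V) : Set where
      constructor ray
      field
        a≢x : a ≢ x
        x≢β : f x ≢ β
        x≢γ : f x ≢ γ

    open Ray

    -- The ends of a hypothetical path y z w off a with colours β and γ.
    record Ends (β γ : C) (y w : V) : Set where
      field
        β≢γ : β ≢ γ
        a≢y : a ≢ y
        a≢w : a ≢ w
        y≢w : y ≢ w
        y∈  : f y ≡ β ⊎ f y ≡ γ
        w∈  : f w ≡ β ⊎ f w ≡ γ

    open Ends

    flip-ray : ∀ {β γ x} → Ray β γ x → Ray γ β x
    flip-ray (ray a≢x x≢β x≢γ) = ray a≢x x≢γ x≢β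

    -- Reading the path `y z w` backwards exchanges its ends and its colours, so whatever is shown
    -- at `y` transfers to `w`.
    flip-ends : ∀ {β γ y w} → Ends β γ y w → Ends γ β w y
    flip-ends E = record
      { β≢γ = ≢-sym (β≢γ E) ; a≢y = a≢w E ; a≢w = a≢y E ; y≢w = ≢-sym (y≢w E)
      ; y∈ = Sum.swap (w∈ E) ; w∈ = Sum.swap (y∈ E) }

    ≢ray : ∀ {β γ v x} → f v ≡ β ⊎ f v ≡ γ → Ray β γ x → v ≢ x
    ≢ray v∈ X refl = [ x≢β X , x≢γ X ]′ v∈

    module _ {β γ y w} (E : Ends β γ y w) where

      -- The broom from `y` leaves `β` or `f z` for `c x x′`, the broom from `w` leaves `γ` or
      -- `f z`; only `f z` is common.
      hub-rays : ∀ {z x x′} → Ray β γ z → Ray β γ x → Ray β γ x′ →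
        c y z ≡ β → c w z ≡ γ → f z ≢ f x → f z ≢ f x′ → f x ≢ f x′ →
        c x x′ ≡ f z
      hub-rays Z X X′ refl refl z≢x z≢x′ x≢x′
        with broom-closes (a≢y E) (a≢x Z) (a≢x X) (a≢x X′)
               (≢ray (y∈ E) Z) (≢ray (y∈ E) X) (≢ray (y∈ E) X′)
               (≢-sym (x≢β Z)) (≢-sym (x≢β X)) (≢-sym (x≢β X′)) z≢x z≢x′ x≢x′
           | broom-closes (a≢w E) (a≢x Z) (a≢x X) (a≢x X′)
               (≢ray (w∈ E) Z) (≢ray (w∈ E) X) (≢ray (w∈ E) X′)
               (≢-sym (x≢γ Z)) (≢-sym (x≢γ X)) (≢-sym (x≢γ X′)) z≢x z≢x′ x≢x′
      ... | inj₂ eq | _ = eq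
      ... | inj₁ _ | inj₂ eq = eq
      ... | inj₁ eq | inj₁ eq′ = ⊥-elim (β≢γ E (trans (sym eq) eq′))

      -- Suppose `c y x` is not `β`. If it is `γ` or `f z`, the path `x′ a x y z` is rainbow; if
      -- not, `w z y x x′` is, with last colour `f z` by `hub-rays`.
      hub-ray-end : ∀ {z x x′} → Ray β γ z → Ray β γ x → Ray β γ x′ →
        c y z ≡ β → c w z ≡ γ → f z ≢ f x → f z ≢ f x′ → f x ≢ f x′ →
        c y x ≡ β
      hub-ray-end {z} {x} {x′} Z X X′ refl refl z≢x z≢x′ x≢x′ =
        decidable-stable (c y x Fin.≟ c y z) contra
        where
        spoke : c y x ≢ f x → c y x ≢ f x′ → c y x ≢ c y z → ⊥
        spoke ≢x ≢x′ ≢β = no-spoke (a≢x X′) (a≢x X) (a≢y E) (a≢x Z)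
          (≢-sym (≢ray (y∈ E) X′)) (≢-sym (apart z≢x′))
          (≢-sym (≢ray (y∈ E) X)) (≢-sym (apart z≢x)) (≢ray (y∈ E) Z)
          ((≢-sym x≢x′ ∷ ≢-sym (by-sym ≢x′) ∷ x≢β X′ ∷ [])
          ∷ (≢-sym (by-sym ≢x) ∷ x≢β X ∷ [])
          ∷ (by-sym ≢β ∷ []) ∷ [] ∷ [])

        contra : c y x ≢ c y z → ⊥
        contra ≢β with c y x Fin.≟ c w z | c y x Fin.≟ f z
        ... | yes eq | _ = spoke (λ eq′ → x≢γ X (trans (sym eq′) eq))
          (λ eq′ → x≢γ X′ (trans (sym eq′) eq)) ≢β
        ... | no _ | yes eq = spoke (λ eq′ → z≢x (trans (sym eq) eq′))
          (λ eq′ → z≢x′ (trans (sym eq) eq′)) ≢β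
        -- the path w z y x x′
        ... | no ≢γ | no ≢z = no-rainbow
          ( (≢ray (w∈ E) Z ∷ ≢-sym (y≢w E) ∷ ≢ray (w∈ E) X ∷ ≢ray (w∈ E) X′ ∷ [])
          ∷ (≢-sym (≢ray (y∈ E) Z) ∷ apart z≢x ∷ apart z≢x′ ∷ [])
          ∷ (≢ray (y∈ E) X ∷ ≢ray (y∈ E) X′ ∷ [])
          ∷ (apart x≢x′ ∷ []) ∷ [] ∷ [])
          (subst₂ (λ p q → Unique (c w z ∷ p ∷ c y x ∷ q ∷ []))
            (c-sym y z) (sym (hub-rays Z X X′ refl refl z≢x z≢x′ x≢x′))
            ((≢-sym (β≢γ E) ∷ ≢-sym ≢γ ∷ ≢-sym (x≢γ Z) ∷ [])
            ∷ (≢-sym ≢β ∷ ≢-sym (x≢β Z) ∷ [])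
            ∷ (≢z ∷ []) ∷ [] ∷ []))

    Hub : (β γ : C) (y w z : V) → Set
    Hub β γ y w z = Ray β γ z × c y z ≡ β × c w z ≡ γ

    -- Two applications of `hub-ray-end`, one for each end; `x′` only serves as the auxiliary second
    -- ray.
    hub-spreads : ∀ {β γ y w z x x′} → Ends β γ y w → Hub β γ y w z →
      Ray β γ x → Ray β γ x′ → f z ≢ f x → f z ≢ f x′ → f x ≢ f x′ →
      Hub β γ y w x
    hub-spreads E (Z , yz , wz) X X′ z≢x z≢x′ x≢x′ =
      X , hub-ray-end E Z X X′ yz wz z≢x z≢x′ x≢x′
        , hub-ray-end (flip-ends E) (flip-ray Z) (flip-ray X) (flip-ray X′)
            wz yz z≢x z≢x′ x≢x′

    -- Given the hub z and rays x₁, x₂, x₃, also x₂ and x₃ are hubs, so c z x₁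
    -- is both f x₂ and f x₃.
    no-hub : Trichromatic → ∀ {β γ y w z} → Ends β γ y w → ¬ Hub β γ y w z
    no-hub tri {β} {γ} {y} {w} {z} E H@(Z , yz , wz)
      with sees-beyond tri (β ∷ γ ∷ f z ∷ []) (ℕ.m≤m+n 3 2)
    ... | x₁ , a≢x₁ , x₁≢β ∷ x₁≢γ ∷ x₁≢z ∷ []
      with sees-beyond tri (β ∷ γ ∷ f z ∷ f x₁ ∷ []) (ℕ.m≤m+n 4 1)
    ... | x₂ , a≢x₂ , x₂≢β ∷ x₂≢γ ∷ x₂≢z ∷ x₂≢x₁ ∷ []
      with sees-beyond tri (β ∷ γ ∷ f z ∷ f x₁ ∷ f x₂ ∷ []) ℕ.≤-refl
    ... | x₃ , a≢x₃ , x₃≢β ∷ x₃≢γ ∷ x₃≢z ∷ x₃≢x₁ ∷ x₃≢x₂ ∷ [] =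
      x₃≢x₂ (trans (sym (zx₁ X₃ x₃≢z x₃≢x₁)) (zx₁ X₂ x₂≢z x₂≢x₁))
      where
      X₁ = ray {β} {γ} a≢x₁ x₁≢β x₁≢γ
      X₂ = ray {β} {γ} a≢x₂ x₂≢β x₂≢γ
      X₃ = ray {β} {γ} a≢x₃ x₃≢β x₃≢γ

      zx₁ : ∀ {x} → Ray β γ x → f x ≢ f z → f x ≢ f x₁ → c z x₁ ≡ f x
      zx₁ X x≢z x≢x₁ =
        let _ , yx , wx = hub-spreads E H X X₁ (≢-sym x≢z) (≢-sym x₁≢z) x≢x₁
        in hub-rays E X Z X₁ yx wx x≢z x≢x₁ (≢-sym x₁≢z)

    -- Otherwise a vertex `x` of a sixth colour makes `x a y z w` rainbow. Excluding `f z` and `f w`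
    -- keeps `x` apart from `z` and `w`.
    end-colour : Trichromatic → ∀ {y z w} → a ≢ y → a ≢ z → a ≢ w →
      y ≢ z → y ≢ w → w ≢ z → c y z ≢ c w z → f y ≡ c y z ⊎ f y ≡ c w z
    end-colour tri {y} {z} {w} a≢y a≢z a≢w y≢z y≢w w≢z ne
      with f y Fin.≟ c y z | f y Fin.≟ c w z
    ... | yes eq | _ = inj₁ eq
    ... | no _ | yes eq = inj₂ eq
    ... | no ≢β | no ≢γ
      with sees-beyond tri (c y z ∷ c w z ∷ f y ∷ f z ∷ f w ∷ []) ℕ.≤-refl
    ... | x , a≢x , x≢β ∷ x≢γ ∷ x≢y ∷ x≢z ∷ x≢w ∷ [] = ⊥-elim
      (no-spoke a≢x a≢y a≢z a≢w (apart x≢z) (apart x≢w) y≢z y≢w (≢-sym w≢z)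
        (subst (λ p → Unique (f x ∷ f y ∷ c y z ∷ p ∷ [])) (c-sym w z)
          ((x≢y ∷ x≢β ∷ x≢γ ∷ []) ∷ (≢β ∷ ≢γ ∷ []) ∷ (ne ∷ []) ∷ [] ∷ [])))

    -- The broom starts at the end whose edge to `z` has the colour other than `f z`, so its handle
    -- carries both `β` and `γ`.
    rays-joined : ∀ {β γ y z w x x′} → Ends β γ y w →
      a ≢ z → y ≢ z → w ≢ z → c y z ≡ β → c w z ≡ γ → f z ≡ β ⊎ f z ≡ γ →
      Ray β γ x → Ray β γ x′ → f x ≢ f x′ →
      c x x′ ≡ β ⊎ c x x′ ≡ γ
    rays-joined E a≢z y≢z w≢z refl refl (inj₁ z≡β) X X′ x≢x′ =
      Sum.swap (Sum.map₂ (λ eq → trans eq z≡β)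
      (broom-closes (a≢w E) a≢z (a≢x X) (a≢x X′)
        w≢z (≢ray (w∈ E) X) (≢ray (w∈ E) X′)
        (λ eq → β≢γ E (sym (trans eq z≡β))) (≢-sym (x≢γ X)) (≢-sym (x≢γ X′))
        (λ eq → x≢β X (trans (sym eq) z≡β)) (λ eq → x≢β X′ (trans (sym eq) z≡β))
        x≢x′))
    rays-joined E a≢z y≢z w≢z refl refl (inj₂ z≡γ) X X′ x≢x′ =
      Sum.map₂ (λ eq → trans eq z≡γ)
      (broom-closes (a≢y E) a≢z (a≢x X) (a≢x X′)
        y≢z (≢ray (y∈ E) X) (≢ray (y∈ E) X′)
        (λ eq → β≢γ E (trans eq z≡γ)) (≢-sym (x≢β X)) (≢-sym (x≢β X′))
        (λ eq → x≢γ X (trans (sym eq) z≡γ)) (λ eq → x≢γ X′ (trans (sym eq) z≡γ))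
        x≢x′)

    module _ (tri : Trichromatic) {β γ y z w} (E : Ends β γ y w)
      (a≢z : a ≢ z) (y≢z : y ≢ z) (w≢z : w ≢ z)
      (yz : c y z ≡ β) (wz : c w z ≡ γ) (z∈ : f z ≡ β ⊎ f z ≡ γ) where

      -- If `c y x` is neither `β` nor `f x`, a ray `x′` of yet another colour makes `x′ a x y z`
      -- rainbow.
      ray-end : ∀ {x} → Ray β γ x → c y x ≢ β → c y x ≡ f x
      ray-end {x} X ≢β = decidable-stable (c y x Fin.≟ f x) contra
        where
        contra : c y x ≢ f x → ⊥
        contra ≢x with sees-beyond tri (β ∷ γ ∷ f x ∷ c y x ∷ []) (ℕ.m≤m+n 4 1)
        ... | x′ , a≢x′ , x′≢β ∷ x′≢γ ∷ x′≢x ∷ x′≢yx ∷ [] =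
          no-spoke a≢x′ (a≢x X) (a≢y E) a≢z
            (≢-sym (≢ray (y∈ E) X′)) (≢-sym (≢ray z∈ X′))
            (≢-sym (≢ray (y∈ E) X)) (≢-sym (≢ray z∈ X)) y≢z
            (subst₂ (λ p q → Unique (f x′ ∷ f x ∷ p ∷ q ∷ [])) (c-sym y x) (sym yz)
              ((x′≢x ∷ x′≢yx ∷ x′≢β ∷ []) ∷ (≢-sym ≢x ∷ x≢β X ∷ [])
              ∷ (≢β ∷ []) ∷ [] ∷ []))
          where
          X′ = ray {β} {γ} a≢x′ x′≢β x′≢γ

      -- If both edges at `y` avoided `β`, they would have colours `f x` and `f x′` by `ray-end`. A
      -- third ray `v` is joined to `x` in `β` or `γ`, which completes a rainbow path.
      rays-ends : ∀ {x x′} → Ray β γ x → Ray β γ x′ → f x ≢ f x′ →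
        c y x ≢ β → c y x′ ≡ β
      rays-ends {x} {x′} X X′ x≢x′ ≢β =
        decidable-stable (c y x′ Fin.≟ β) contra
        where
        contra : c y x′ ≢ β → ⊥
        contra ≢β′
          with sees-beyond tri (β ∷ γ ∷ f x ∷ f x′ ∷ []) (ℕ.m≤m+n 4 1)
        -- the path a v x y x′
        ... | v , a≢v , v≢β ∷ v≢γ ∷ v≢x ∷ v≢x′ ∷ [] = no-rainbow
          ( (a≢v ∷ a≢x X ∷ a≢y E ∷ a≢x X′ ∷ [])
          ∷ (apart v≢x ∷ ≢-sym (≢ray (y∈ E) R) ∷ apart v≢x′ ∷ [])
          ∷ (≢-sym (≢ray (y∈ E) X) ∷ apart x≢x′ ∷ [])
          ∷ (≢ray (y∈ E) X′ ∷ []) ∷ [] ∷ [])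
          (subst₂ (λ p q → Unique (f v ∷ c v x ∷ p ∷ q ∷ []))
            (trans (sym (ray-end X ≢β)) (c-sym y x)) (sym (ray-end X′ ≢β′))
            ((outside R ∷ v≢x ∷ v≢x′ ∷ [])
            ∷ (≢-sym (outside X) ∷ ≢-sym (outside X′) ∷ [])
            ∷ (x≢x′ ∷ []) ∷ [] ∷ []))
          where
          R = ray {β} {γ} a≢v v≢β v≢γ

          outside : ∀ {u} → Ray β γ u → f u ≢ c v x
          outside U eq with rays-joined E a≢z y≢z w≢z yz wz z∈ R X v≢x
          ... | inj₁ ≡β = x≢β U (trans eq ≡β)
          ... | inj₂ ≡γ = x≢γ U (trans eq ≡γ)

    -- Two rays with c y x ≢ β would make a rainbow path a v x y x′ (rays-ends),
    -- likewise for w, so one of three rays is a hub.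
    some-hub : Trichromatic → ∀ {β γ y z w} → Ends β γ y w →
      a ≢ z → y ≢ z → w ≢ z → c y z ≡ β → c w z ≡ γ → f z ≡ β ⊎ f z ≡ γ →
      ∃ (Hub β γ y w)
    some-hub tri {β} {γ} {y} {z} {w} E a≢z y≢z w≢z yz wz z∈
      with sees-beyond tri (β ∷ γ ∷ []) (ℕ.m≤m+n 2 3)
    ... | x₁ , a≢x₁ , x₁≢β ∷ x₁≢γ ∷ []
      with sees-beyond tri (β ∷ γ ∷ f x₁ ∷ []) (ℕ.m≤m+n 3 2)
    ... | x₂ , a≢x₂ , x₂≢β ∷ x₂≢γ ∷ x₂≢x₁ ∷ []
      with sees-beyond tri (β ∷ γ ∷ f x₁ ∷ f x₂ ∷ []) (ℕ.m≤m+n 4 1)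
    ... | x₃ , a≢x₃ , x₃≢β ∷ x₃≢γ ∷ x₃≢x₁ ∷ x₃≢x₂ ∷ [] = choose
      where
      X₁ = ray {β} {γ} a≢x₁ x₁≢β x₁≢γ
      X₂ = ray {β} {γ} a≢x₂ x₂≢β x₂≢γ
      X₃ = ray {β} {γ} a≢x₃ x₃≢β x₃≢γ

      at-y : ∀ {x x′} → Ray β γ x → Ray β γ x′ → f x ≢ f x′ →
        c y x ≢ β → c y x′ ≡ β
      at-y = rays-ends tri E a≢z y≢z w≢z yz wz z∈

      at-w : ∀ {x x′} → Ray β γ x → Ray β γ x′ → f x ≢ f x′ →
        c w x ≢ γ → c w x′ ≡ γ
      at-w X X′ = rays-ends tri (flip-ends E) a≢z w≢z y≢z wz yz (Sum.swap z∈)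
                    (flip-ray X) (flip-ray X′)

      choose : ∃ (Hub β γ y w)
      choose with c y x₁ Fin.≟ β | c w x₁ Fin.≟ γ | c y x₂ Fin.≟ β | c w x₂ Fin.≟ γ
      ... | yes yx₁ | yes wx₁ | _ | _ = x₁ , X₁ , yx₁ , wx₁
      ... | _ | _ | yes yx₂ | yes wx₂ = x₂ , X₂ , yx₂ , wx₂
      ... | no ≢β | _ | _ | no ≢γ =
        x₃ , X₃ , at-y X₁ X₃ (≢-sym x₃≢x₁) ≢β , at-w X₂ X₃ (≢-sym x₃≢x₂) ≢γ
      ... | _ | no ≢γ | no ≢β | _ =
        x₃ , X₃ , at-y X₂ X₃ (≢-sym x₃≢x₂) ≢β , at-w X₁ X₃ (≢-sym x₃≢x₁) ≢γ
      ... | no ≢β | _ | no ≢β′ | _ =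
        ⊥-elim (≢β′ (at-y X₁ X₂ (≢-sym x₂≢x₁) ≢β))
      ... | _ | no ≢γ | _ | no ≢γ′ =
        ⊥-elim (≢γ′ (at-w X₁ X₂ (≢-sym x₂≢x₁) ≢γ))

    -- If the colours differ, a hub exists, against `no-hub`: `z` itself when `f z` is neither of
    -- them, and otherwise the one from `some-hub`.
    adjacent-equal : Trichromatic → ∀ {y z w} → a ≢ y → a ≢ z → a ≢ w →
      y ≢ z → w ≢ z → c y z ≡ c w z
    adjacent-equal tri {y} {z} {w} a≢y a≢z a≢w y≢z w≢z =
      decidable-stable (c y z Fin.≟ c w z) contra
      where
      contra : c y z ≢ c w z → ⊥
      contra ne = hub (f z Fin.≟ c y z) (f z Fin.≟ c w z)
        where
        distinct : y ≢ w
        distinct refl = ne refl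

        E : Ends (c y z) (c w z) y w
        E = record
          { β≢γ = ne ; a≢y = a≢y ; a≢w = a≢w ; y≢w = distinct
          ; y∈ = end-colour tri a≢y a≢z a≢w y≢z distinct w≢z ne
          ; w∈ = Sum.swap
              (end-colour tri a≢w a≢z a≢y w≢z (≢-sym distinct) y≢z (≢-sym ne)) }

        via : f z ≡ c y z ⊎ f z ≡ c w z → ⊥
        via z∈ = no-hub tri E
          (proj₂ (some-hub tri E a≢z y≢z w≢z refl refl z∈))

        hub : Dec (f z ≡ c y z) → Dec (f z ≡ c w z) → ⊥
        hub (yes eq) _ = via (inj₁ eq)
        hub _ (yes eq) = via (inj₂ eq)
        hub (no z≢β) (no z≢γ) = no-hub tri E (ray a≢z z≢β z≢γ , refl , refl)

  -- Transversals, and their construction around a trichromatic vertex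

  -- The representatives span a complete graph on k - 1 vertices, monochromatic in `α`.
  Transversal : C → Set
  Transversal α = ∃ λ (rep : ∀ i → i ≢ α → V) →
    ∀ {i j} (i≢α : i ≢ α) (j≢α : j ≢ α) → i ≢ j →
    rep i i≢α ≢ rep j j≢α × c (rep i i≢α) (rep j j≢α) ≡ α

  -- Here `α` is the one colour used off `a`. Every other colour occurs only on edges at `a`, and
  -- the far ends of such edges are the representatives.
  trichromatic⇒transversal : ∀ a → At.Trichromatic a → ∃ Transversal
  trichromatic⇒transversal a tri
    with fresh (a ∷ []) (ℕ.≤-trans (ℕ.m≤m+n 2 3) n≥5)
  ... | y , y≢a ∷ []
    with fresh (a ∷ y ∷ []) (ℕ.≤-trans (ℕ.m≤m+n 3 2) n≥5)
  ... | z , z≢a ∷ z≢y ∷ [] =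
    c y z
    , (λ i i≢α → proj₁ (spoke i i≢α))
    , λ i≢α j≢α i≢j →
        let u , a≢u , u≡i = spoke _ i≢α
            v , a≢v , v≡j = spoke _ j≢α
            u≢v = λ u≡v → i≢j (trans (sym u≡i) (trans (cong (c a) u≡v) v≡j))
        in u≢v , off a≢u a≢v u≢v
    where
    adjacent : ∀ {u v w} → a ≢ u → a ≢ v → a ≢ w → u ≢ v → w ≢ v → c u v ≡ c w v
    adjacent = At.adjacent-equal a tri

    at-y : ∀ {v} → a ≢ v → v ≢ y → c v y ≡ c y z
    at-y a≢v v≢y = trans
      (adjacent a≢v (≢-sym y≢a) (≢-sym z≢a) v≢y z≢y) (c-sym z y)

    -- The edges `u v`, `v y`, `y z` are consecutively adjacent, so `adjacent` carries the colour
    -- along.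
    off : ∀ {u v} → a ≢ u → a ≢ v → u ≢ v → c u v ≡ c y z
    off {u} {v} a≢u a≢v u≢v with v Fin.≟ y
    ... | yes refl = at-y a≢u u≢v
    ... | no v≢y = trans (adjacent a≢u a≢v (≢-sym y≢a) u≢v (≢-sym v≢y))
                     (trans (c-sym y v) (at-y a≢v v≢y))

    spoke : ∀ i → i ≢ c y z → ∃ λ v → a ≢ v × c a v ≡ i
    spoke i i≢α with onto i
    ... | u , v , u≢v , uv≡i with a Fin.≟ u | a Fin.≟ v
    ... | yes refl | _ = v , u≢v , uv≡i
    ... | no a≢u | yes refl = u , a≢u , trans (c-sym v u) uv≡i
    ... | no a≢u | no a≢v =
      contradiction (trans (sym uv≡i) (off a≢u a≢v u≢v)) i≢α

  -- Colourings in which every vertex sees at most two colours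

  Sees : V → C → Set
  Sees v i = ∃ λ u → v ≢ u × c v u ≡ i

  -- When every vertex sees at most two colours, the colour pairs of any two
  -- vertices meet, since the vertices are joined by an edge.
  module _ (bichromatic : ∀ a → ¬ At.Trichromatic a) where

    sees-two : ∀ {v i j l} → Sees v i → Sees v j → Sees v l →
      i ≢ j → l ≡ i ⊎ l ≡ j
    sees-two {v} {i} {j} {l} (x , v≢x , refl) (y , v≢y , refl) (z , v≢z , refl) i≢j
      with c v z Fin.≟ c v x | c v z Fin.≟ c v y
    ... | yes eq | _ = inj₁ eq
    ... | no _ | yes eq = inj₂ eq
    ... | no z≢x | no z≢y = ⊥-elim (bichromatic v
      (x , y , z , v≢x ∷ v≢y ∷ v≢z ∷ []
      , (i≢j ∷ ≢-sym z≢x ∷ []) ∷ (≢-sym z≢y ∷ []) ∷ [] ∷ []))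

    sees-edge : ∀ {u v} → u ≢ v → Sees v (c u v)
    sees-edge {u} {v} u≢v = u , ≢-sym u≢v , c-sym v u

    -- Take an edge at `u` of colour `α` and one at `v` of colour `β`. If `u` and `v` differ, the
    -- edge between them gives `v` the colour `α` or gives `u` a second colour.
    two-coloured : ∃ λ v → ∃₂ λ α β → α ≢ β × Sees v α × Sees v β
    two-coloured with fresh {k} [] (ℕ.≤-trans (ℕ.m≤m+n 1 6) k≥7)
    ... | α , [] with fresh (α ∷ []) (ℕ.≤-trans (ℕ.m≤m+n 2 5) k≥7)
    ... | β , β≢α ∷ [] with onto α | onto β
    ... | u , x , u≢x , ux | v , y , v≢y , vy with u Fin.≟ v | c u v Fin.≟ α
    ... | yes refl | _ = u , α , β , ≢-sym β≢α , (x , u≢x , ux) , (y , v≢y , vy)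
    ... | no u≢v | yes uv≡α = v , α , β , ≢-sym β≢α
      , (u , ≢-sym u≢v , trans (c-sym v u) uv≡α) , (y , v≢y , vy)
    ... | no u≢v | no uv≢α = u , c u v , α , uv≢α , (v , u≢v , refl) , (x , u≢x , ux)

    -- A vertex w that sees a fourth colour i also shares α with v: otherwise
    -- its pair {i , β} is disjoint from the pair {γ , α} of u.
    centred : ∀ {v α β u γ} → α ≢ β → Sees v α → Sees v β →
      γ ≢ α → γ ≢ β → Sees u γ → Sees u α →
      ∀ i → i ≢ α → ∃ λ w → Sees w i × Sees w α
    centred {v} {α} {β} {u} {γ} α≢β vα vβ γ≢α γ≢β uγ uα i i≢α
      with i Fin.≟ β | i Fin.≟ γ
    ... | yes refl | _ = v , vβ , vα
    ... | no _ | yes refl = u , uγ , uα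
    ... | no i≢β | no i≢γ with onto i
    ... | w , x , w≢x , wx≡i = w , wi , wα
      where
      wi : Sees w i
      wi = x , w≢x , wx≡i

      unlike : ∀ {v α β} → Sees v α → Sees v β → α ≢ β → i ≢ α → i ≢ β → w ≢ v
      unlike vα vβ α≢β i≢α i≢β refl = [ i≢α , i≢β ]′ (sees-two vα vβ wi α≢β)

      w≢v : w ≢ v
      w≢v = unlike vα vβ α≢β i≢α i≢β
      w≢u : w ≢ u
      w≢u = unlike uγ uα γ≢α i≢γ i≢α

      wα : Sees w α
      wα with sees-two vα vβ (sees-edge w≢v) α≢β
      ... | inj₁ wv≡α = v , w≢v , wv≡α
      ... | inj₂ wv≡β with sees-two uα uγ (sees-edge w≢u) (≢-sym γ≢α)
      ...   | inj₁ wu≡α = u , w≢u , wu≡α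
      ...   | inj₂ wu≡γ
        with sees-two wi (v , w≢v , wv≡β) (u , w≢u , wu≡γ) i≢β
      ...     | inj₁ γ≡i = contradiction (sym γ≡i) i≢γ
      ...     | inj₂ γ≡β = contradiction γ≡β γ≢β

    -- A vertex `u` that sees a third colour `γ` is joined to `v` in one of the two colours of `v`;
    -- that shared colour is the centre.
    centre : ∃ λ α → ∀ i → i ≢ α → ∃ λ w → Sees w i × Sees w α
    centre with two-coloured
    ... | v , α , β , α≢β , vα , vβ
      with fresh (α ∷ β ∷ []) (ℕ.≤-trans (ℕ.m≤m+n 3 4) k≥7)
    ... | γ , γ≢α ∷ γ≢β ∷ [] with onto γ
    ... | u , x , u≢x , ux≡γ = shared (sees-two vα vβ (sees-edge u≢v) α≢β)
      where
      uγ : Sees u γ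
      uγ = x , u≢x , ux≡γ

      u≢v : u ≢ v
      u≢v refl = [ γ≢α , γ≢β ]′ (sees-two vα vβ uγ α≢β)

      shared : c u v ≡ α ⊎ c u v ≡ β →
        ∃ λ α → ∀ i → i ≢ α → ∃ λ w → Sees w i × Sees w α
      shared (inj₁ uv≡α) =
        α , centred α≢β vα vβ γ≢α γ≢β uγ (v , u≢v , uv≡α)
      shared (inj₂ uv≡β) =
        β , centred (≢-sym α≢β) vβ vα γ≢β γ≢α uγ (v , u≢v , uv≡β)

    -- The colour pairs of two representatives meet only in `α`, and the edge between them is seen
    -- by both.
    bichromatic⇒transversal : ∃ Transversal
    bichromatic⇒transversal with centre
    ... | α , rep = α , (λ i i≢α → proj₁ (rep i i≢α)) , λ i≢α j≢α i≢j →
      distinct i≢α j≢α i≢j (rep _ i≢α) (rep _ j≢α)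
      where
      distinct : ∀ {i j} → i ≢ α → j ≢ α → i ≢ j →
        (u : ∃ λ w → Sees w i × Sees w α) (v : ∃ λ w → Sees w j × Sees w α) →
        proj₁ u ≢ proj₁ v × c (proj₁ u) (proj₁ v) ≡ α
      distinct i≢α j≢α i≢j (u , ui , uα) (v , vj , vα) = u≢v , uv≡α
        where
        u≢v : u ≢ v
        u≢v refl = [ ≢-sym i≢j , j≢α ]′ (sees-two ui uα vj i≢α)

        uv≡α : c u v ≡ α
        uv≡α with sees-two ui uα (v , u≢v , refl) i≢α
                | sees-two vj vα (sees-edge u≢v) j≢α
        ... | inj₂ eq | _ = eq
        ... | inj₁ _ | inj₂ eq = eq
        ... | inj₁ eq | inj₁ eq′ = contradiction (trans (sym eq) eq′) i≢j

  transversal : ∃ Transversal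
  transversal with Fin.any? (λ a → Fin.any? (λ x → Fin.any? (λ y → Fin.any? (λ z →
    All.all? (λ v → ¬? (a Fin.≟ v)) (x ∷ y ∷ z ∷ [])
    ×-dec unique? (c a x ∷ c a y ∷ c a z ∷ [])))))
  ... | yes (a , tri) = trichromatic⇒transversal a tri
  ... | no none = bichromatic⇒transversal λ a tri → none (a , tri)

-- From edge colourings to total colour functions, and rainbow copies of P₅

module _ {k n} (χ : Colouring k (complete n)) where

  -- i is a junk value on the diagonal.
  colour-or : Fin k → Fin n → Fin n → Fin k
  colour-or i u v with u Fin.≟ v
  ... | yes _ = i
  ... | no u≢v = colour χ u≢v

  colour-or-≡ : ∀ i {u v} (u≢v : u ≢ v) → colour-or i u v ≡ colour χ u≢v
  colour-or-≡ i {u} {v} u≢v with u Fin.≟ v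
  ... | yes u≡v = contradiction u≡v u≢v
  -- Passing through a proof of `v ≢ u` identifies the colours given by two proofs of `u ≢ v`.
  ... | no u≢v′ = trans (Colouring.undirected χ u≢v′ (≢-sym u≢v))
                    (Colouring.undirected χ (≢-sym u≢v) u≢v)

  colour-or-sym : ∀ i u v → colour-or i u v ≡ colour-or i v u
  colour-or-sym i u v with u Fin.≟ v | v Fin.≟ u
  ... | yes _ | yes _ = refl
  ... | yes u≡v | no v≢u = contradiction (sym u≡v) v≢u
  ... | no u≢v | yes v≡u = contradiction (sym v≡u) u≢v
  ... | no u≢v | no v≢u = Colouring.undirected χ u≢v v≢u

unique⇒copy : ∀ {m n} (G : Graph m) {vs : Vec (Fin n) m} → Unique vs →
  Copy G (complete n)
unique⇒copy G {vs} us = record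
  { to = Vec.lookup vs
  ; injective = λ {i} {j} → lookup-injective us i j
  ; edge = λ {i} {j} e eq → Graph.irrefl G (lookup-injective us i j eq) e
  }

toℕ≡⇒≡inject₁ : ∀ {n} {i : Fin n} {j : Fin (suc n)} → toℕ i ≡ toℕ j → j ≡ inject₁ i
toℕ≡⇒≡inject₁ {i = i} eq = Fin.toℕ-injective (trans (sym eq) (sym (Fin.toℕ-inject₁ i)))

-- Indexing edges by their lower end, in either orientation, turns rainbowness into injectivity of a
-- lookup.
path-edge : ∀ {n} {u v : Fin (suc n)} → Adj (path (suc n)) u v →
  ∃ λ i → (u ≡ inject₁ i × v ≡ suc i) ⊎ (u ≡ suc i × v ≡ inject₁ i)
path-edge {v = suc i} (inj₁ eq) = i , inj₁ (toℕ≡⇒≡inject₁ (ℕ.suc-injective eq) , refl)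
path-edge {u = suc i} (inj₂ eq) = i , inj₂ (refl , toℕ≡⇒≡inject₁ (ℕ.suc-injective eq))

module _ {k n} (χ : Colouring k (complete n)) (i₀ : Fin k) where

  private
    c : Fin n → Fin n → Fin k
    c = colour-or χ i₀

  RainbowPath : (v₁ v₂ v₃ v₄ v₅ : Fin n) → Set
  RainbowPath v₁ v₂ v₃ v₄ v₅ =
    Unique (v₁ ∷ v₂ ∷ v₃ ∷ v₄ ∷ v₅ ∷ []) ×
    Unique (c v₁ v₂ ∷ c v₂ v₃ ∷ c v₃ v₄ ∷ c v₄ v₅ ∷ [])

  rainbowPath? : Dec (∃₂ λ v₁ v₂ → ∃₂ λ v₃ v₄ → ∃ (RainbowPath v₁ v₂ v₃ v₄))
  rainbowPath? = Fin.any? λ _ → Fin.any? λ _ → Fin.any? λ _ → Fin.any? λ _ →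
    Fin.any? λ _ → unique? _ ×-dec unique? _

  rainbow-copy : ∀ {v₁ v₂ v₃ v₄ v₅} → RainbowPath v₁ v₂ v₃ v₄ v₅ →
    ∃ (Rainbow {G = path 5} χ)
  rainbow-copy {v₁} {v₂} {v₃} {v₄} {v₅} (us , cs) = γ , rainbow
    where
    vs : Vec (Fin n) 5
    vs = v₁ ∷ v₂ ∷ v₃ ∷ v₄ ∷ v₅ ∷ []

    es : Vec (Fin k) 4
    es = c v₁ v₂ ∷ c v₂ v₃ ∷ c v₃ v₄ ∷ c v₄ v₅ ∷ []

    γ : Copy (path 5) (complete n)
    γ = unique⇒copy (path 5) us

    step : ∀ i → c (Vec.lookup vs (inject₁ i)) (Vec.lookup vs (suc i)) ≡ Vec.lookup es i
    step zero = refl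
    step (suc zero) = refl
    step (suc (suc zero)) = refl
    step (suc (suc (suc zero))) = refl

    index : ∀ {u v} (e : Adj (path 5) u v) →
      colour χ (Copy.edge γ e) ≡ Vec.lookup es (proj₁ (path-edge e))
    index e with path-edge e
    ... | i , inj₁ (refl , refl) = trans (sym (colour-or-≡ χ i₀ (Copy.edge γ e))) (step i)
    ... | i , inj₂ (refl , refl) = trans (sym (colour-or-≡ χ i₀ (Copy.edge γ e)))
      (trans (colour-or-sym χ i₀ (Vec.lookup vs (suc i)) (Vec.lookup vs (inject₁ i)))
        (step i))

    rainbow : Rainbow χ γ
    rainbow e e′ eq with path-edge e | path-edge e′ | index e | index e′
    ... | i , p | j , q | e≡i | e′≡j
      -- The four colours are distinct, so equal colours force equal edge indices; only orientations
      -- remain to be compared.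
      with refl ← lookup-injective cs i j (trans (sym e≡i) (trans eq e′≡j))
      with p | q
    ... | inj₁ (refl , refl) | inj₁ (refl , refl) = inj₁ (refl , refl)
    ... | inj₁ (refl , refl) | inj₂ (refl , refl) = inj₂ (refl , refl)
    ... | inj₂ (refl , refl) | inj₁ (refl , refl) = inj₂ (refl , refl)
    ... | inj₂ (refl , refl) | inj₂ (refl , refl) = inj₁ (refl , refl)

-- Embedding `H` in the monochromatic complete graph

unavoidable : ∀ {k t n} → k ≥ 7 → k ≥ t + 1 → n ≥ 5 → (H : Graph t) →
  Unavoidable k (path 5) H n
unavoidable {suc k} {t} {n} k≥7 k>t n≥5 H χ exact with rainbowPath? χ zero
... | yes (_ , _ , _ , _ , _ , p) = inj₁ (rainbow-copy χ zero p)
... | no none = inj₂ (γ , α , λ e → trans (sym (colour-or-≡ χ zero (Copy.edge γ e)))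
    (proj₂ (joined (λ eq → Graph.irrefl H eq e))))
  where
  no-rainbow : ∀ {v₁ v₂ v₃ v₄ v₅} → Unique (v₁ ∷ v₂ ∷ v₃ ∷ v₄ ∷ v₅ ∷ []) →
    ¬ Unique (colour-or χ zero v₁ v₂ ∷ colour-or χ zero v₂ v₃ ∷
              colour-or χ zero v₃ v₄ ∷ colour-or χ zero v₄ v₅ ∷ [])
  no-rainbow us cs = none (_ , _ , _ , _ , _ , us , cs)

  onto : ∀ i → ∃₂ λ u v → u ≢ v × colour-or χ zero u v ≡ i
  onto i = let u , v , u≢v , eq = exact i
           in u , v , u≢v , trans (colour-or-≡ χ zero u≢v) eq

  open NoRainbowPath (colour-or χ zero) (colour-or-sym χ zero)
    no-rainbow onto n≥5 k≥7

  α : Fin (suc k)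
  α = proj₁ transversal

  t≤k : t ℕ.≤ k
  t≤k = ℕ.≤-pred (subst (ℕ._≤ suc k) (ℕ.+-comm t 1) k>t)

  -- `punchIn α` skips `α`, so the vertices of `H` are labelled by distinct colours other than `α`.
  -- Here `k` is one less than the number of colours.
  index : Fin t → Fin (suc k)
  index i = punchIn α (inject≤ i t≤k)

  index-injective : ∀ {i j} → index i ≡ index j → i ≡ j
  index-injective eq = Fin.inject≤-injective _ _ _ _ (Fin.punchIn-injective α _ _ eq)

  vertex : Fin t → Fin n
  vertex i = proj₁ (proj₂ transversal) (index i) (Fin.punchInᵢ≢i α _)

  joined : ∀ {i j} → i ≢ j →
    vertex i ≢ vertex j × colour-or χ zero (vertex i) (vertex j) ≡ α
  joined i≢j = proj₂ (proj₂ transversal) _ _ (i≢j ∘ index-injective)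

  γ : Copy H (complete n)
  γ = record
    { to = vertex
    ; injective = λ {i} {j} eq →
        decidable-stable (i Fin.≟ j) (λ i≢j → proj₁ (joined i≢j) eq)
    ; edge = λ e → proj₁ (joined (λ eq → Graph.irrefl H eq e))
    }

-- Least solutions and the binomial coefficient

least : ∀ {P : ℕ → Set} → Decidable P → ∀ n → P n →
  ∃ λ m → P m × ∀ l → P l → m ℕ.≤ l
least P? n p with P? 0
... | yes p₀ = 0 , p₀ , λ _ _ → z≤n
least P? zero p | no ¬p₀ = contradiction p ¬p₀
least P? (suc n) p | no ¬p₀ =
  let m , pm , min = least (P? ∘ suc) n p
  in suc m , pm , λ { zero p₀ → contradiction p₀ ¬p₀ ; (suc l) pl → s≤s (min l pl) }

[1+n]C2 : ∀ n → suc n C 2 ≡ n + n C 2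
[1+n]C2 n = trans (sym (nCk+nC[k+1]≡[n+1]C[k+1] n 1)) (cong (_+ n C 2) (nC1≡n n))

-- `n + suc n` is 2N - 1 for N = `suc n`, without subtraction. Each induction step adds 8(n + 1) to
-- both sides.
odd-square : ∀ n → (n + suc n) * (n + suc n) ≡ 1 + 8 * (suc n C 2)
odd-square zero = refl
odd-square (suc n) = begin
  (suc n + suc (suc n)) * (suc n + suc (suc n)) ≡⟨ expand n ⟩
  (n + suc n) * (n + suc n) + 8 * suc n         ≡⟨ cong (_+ 8 * suc n) (odd-square n) ⟩
  1 + 8 * (suc n C 2) + 8 * suc n               ≡⟨ collect (suc n C 2) (suc n) ⟩
  1 + 8 * (suc n + suc n C 2)                   ≡⟨ cong (λ m → 1 + 8 * m) ([1+n]C2 (suc n)) ⟨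
  1 + 8 * (suc (suc n) C 2)                     ∎
  where
  open ≡-Reasoning
  open +-*-Solver
  expand : ∀ n → (suc n + suc (suc n)) * (suc n + suc (suc n))
               ≡ (n + suc n) * (n + suc n) + 8 * suc n
  expand = solve 1 (λ n →
    (con 1 :+ n :+ (con 2 :+ n)) :* (con 1 :+ n :+ (con 2 :+ n))
    := (n :+ (con 1 :+ n)) :* (n :+ (con 1 :+ n)) :+ con 8 :* (con 1 :+ n)) refl
  collect : ∀ m n → 1 + 8 * m + 8 * n ≡ 1 + 8 * (n + m)
  collect = solve 2 (λ m n →
    con 1 :+ con 8 :* m :+ con 8 :* n := con 1 :+ con 8 :* (n :+ m)) refl

-- The ceiling, computed in the Dedekind cut

-- A literal fraction with denominator 1, whose parts unfold where `i / 1` is blocked by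
-- normalisation.
fromℤ : ℤ → ℚ
fromℤ i = mkℚ i 0 (coprime-sym (1-coprimeTo _))

i/1≡fromℤ : ∀ i → i ℚ./ 1 ≡ fromℤ i
i/1≡fromℤ i = ℚ.↥p/↧p≡p (fromℤ i)

fromℤ-+ : ∀ i j → fromℤ i ℚ.+ fromℤ j ≡ fromℤ (i ℤ.+ j)
fromℤ-+ i j = trans
  (cong (ℚ._/ 1) (cong₂ ℤ._+_ (ℤ.*-identityʳ i) (ℤ.*-identityʳ j)))
  (i/1≡fromℤ (i ℤ.+ j))

fromℤ-* : ∀ i j → fromℤ i ℚ.* fromℤ j ≡ fromℤ (i ℤ.* j)
fromℤ-* i j = i/1≡fromℤ (i ℤ.* j)

fromℤ-mono-< : ∀ {i j} → i ℤ.< j → fromℤ i ℚ.< fromℤ j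
fromℤ-mono-< {i} {j} i<j =
  ℚ.*<* (subst₂ ℤ._<_ (sym (ℤ.*-identityʳ i)) (sym (ℤ.*-identityʳ j)) i<j)

fromℤ-cancel-< : ∀ {i j} → fromℤ i ℚ.< fromℤ j → i ℤ.< j
fromℤ-cancel-< {i} {j} (ℚ.*<* i<j) =
  subst₂ ℤ._<_ (ℤ.*-identityʳ i) (ℤ.*-identityʳ j) i<j

bound : ℕ → ℝ
bound k = ½* (1ℚ +ʳ √ (1 + 8 * k))

-- Membership of q in the lower cut of `bound k` unfolds to membership of q + q - 1 in that of the
-- square root.
double-1 : ∀ i → (i ℚ./ 1) ℚ.+ (i ℚ./ 1) ℚ.- 1ℚ ≡ fromℤ (i ℤ.+ i ℤ.- ℤ.1ℤ)
double-1 i rewrite i/1≡fromℤ i | fromℤ-+ i i = fromℤ-+ (i ℤ.+ i) (ℤ.- ℤ.1ℤ)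

-- 2N - 1 is not negative for N ≥ 1, so its square lies below 1 + 8k; `odd-square` then leaves a
-- factor 8 to cancel.
L⇒< : ∀ k n → ℝ.L (bound k) ((+ suc n) ℚ./ 1) → suc n C 2 ℕ.< k
L⇒< k n l rewrite double-1 (+ suc n) with l
... | inj₁ neg with fromℤ-cancel-< {j = ℤ.0ℤ} neg
...   | +<+ ()
L⇒< k n l | inj₂ lt rewrite i/1≡fromℤ (+ (1 + 8 * k))
  | fromℤ-* (+ (n + suc n)) (+ (n + suc n)) | sym (ℤ.pos-* (n + suc n) (n + suc n))
  | odd-square n = 
  ℕ.*-cancelˡ-< 8 _ _ (ℕ.≤-pred (ℤ.drop‿+<+ (fromℤ-cancel-< lt)))

<⇒L : ∀ k n → suc n C 2 ℕ.< k → ℝ.L (bound k) ((+ suc n) ℚ./ 1)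
<⇒L k n lt rewrite double-1 (+ suc n) | i/1≡fromℤ (+ (1 + 8 * k))
  | fromℤ-* (+ (n + suc n)) (+ (n + suc n)) | sym (ℤ.pos-* (n + suc n) (n + suc n))
  | odd-square n =
  inj₂ (fromℤ-mono-< (+<+ (s≤s (ℕ.*-monoʳ-< 8 lt))))

nonPositive⇒L : ∀ k i → i ℤ.≤ ℤ.0ℤ → ℝ.L (bound k) (i ℚ./ 1)
nonPositive⇒L k i i≤0 rewrite double-1 i =
  inj₁ (fromℤ-mono-< {j = ℤ.0ℤ} (ℤ.+-mono-≤-< (ℤ.+-mono-≤ i≤0 i≤0) -<+))

-- A positive integer M lies below the bound exactly when `M C 2` is less than k. Integers M ≤ 0 lie
-- below it because 2M - 1 is negative.
bound-ceiling : ∀ {k n} → suc n C 2 ≥ k → (∀ m → m C 2 ≥ k → suc n ℕ.≤ m) →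
  IsCeiling (bound k) (+ suc n)
bound-ceiling {k} {n} big min =
  (λ l → ℕ.<⇒≱ (L⇒< k n l) big)
  , λ m ¬l → ℤ.≮⇒≥ (λ m<n → ¬l (below m m<n))
  where
  below : ∀ m → m ℤ.< + suc n → ℝ.L (bound k) (m ℚ./ 1)
  below (+ zero) _ = nonPositive⇒L k ℤ.0ℤ ℤ.≤-refl
  below -[1+ m ] _ = nonPositive⇒L k -[1+ m ] ℤ.-≤+
  below (+ suc m) (+<+ m<n) = <⇒L k m (ℕ.≰⇒> λ k≤ → ℕ.<⇒≱ m<n (min (suc m) k≤))

-- K₄ has only six edges.
C2⇒≥5 : ∀ n → n C 2 ≥ 7 → n ≥ 5
C2⇒≥5 n big = ℕ.≮⇒≥ λ n<5 → ℕ.<⇒≱ (small n n<5) big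
  where
  small : ∀ n → n ℕ.< 5 → n C 2 ℕ.< 7
  small 0 _ = ℕ.m≤m+n 1 6
  small 1 _ = ℕ.m≤m+n 1 6
  small 2 _ = ℕ.m≤m+n 2 5
  small 3 _ = ℕ.m≤m+n 4 3
  small 4 _ = ℕ.≤-refl
  small (suc (suc (suc (suc (suc n))))) n<5 = contradiction n<5 (ℕ.≤⇒≯ (ℕ.m≤m+n 5 n))

theorem2p1 : (k t : ℕ) → k ≥ 7 → k ≥ t + 1 → (H : Graph t) → NonEmpty H →
    ∃[ N ] IsCeiling (½* (1ℚ +ʳ √ (1 + 8 * k))) (+ N) ×
    IsGallaiRamsey k (path 5) H N
theorem2p1 k t k≥7 k>t H _
  -- The search may stop at `suc k`, since `suc k C 2` is k + `k C 2`.
  with least (λ n → k ℕ.≤? n C 2) (suc k)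
         (subst (k ℕ.≤_) (sym ([1+n]C2 k)) (ℕ.m≤m+n k (k C 2)))
... | zero , big , _ = contradiction (C2⇒≥5 0 (ℕ.≤-trans k≥7 big)) λ()
... | suc n , big , min =
  suc n , bound-ceiling big min
  , (big , λ m m≥n → unavoidable k≥7 k>t
      (ℕ.≤-trans (C2⇒≥5 (suc n) (ℕ.≤-trans k≥7 big)) m≥n) H)
  , λ m (big′ , _) → min m big′
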